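{- Let $N$ be a positive integer and $|q|<1$. Then \begin{align*} \sum_{n=0}^{\infty}\frac{(q)_{\infty}}{(q)_{n}}\left[(q^{n+1})_{N}-1\right] = \sum_{n=1}^{\infty}\genfrac{[}{]}{0pt}{}{N}{n}_{q}(-1)^nq^{\frac{n(n+1)}{2}}\frac{(q)_{n}}{(1-q^n)}. \end{align*}
   Context: Here $(a)_n=(a;q)_n=\prod_{j=0}^{n-1}(1-aq^j)$, $(a)_\infty=\prod_{j\ge0}(1-aq^j)$, and $\genfrac{[}{]}{0pt}{}{N}{n}_q=\frac{(q)_N}{(q)_{N-n}(q)_n}$ is the $q$-binomial coefficient (equal to $0$ for $n>N$). -}

module Defs where

open import Data.Nat as ℕ using (ℕ; zero; suc; _≤_; _≤ᵇ_; _≡ᵇ_)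
open import Data.Nat.DivMod using (_/_)
open import Data.Integer as ℤ using (ℤ; +_; -_; _+_; _*_; _-_; _^_)
open import Data.Bool using (if_then_else_)
open import Data.Product using (∃-syntax; _×_)
open import Relation.Binary.PropositionalEquality using (_≡_)

-- Formal power series in q with integer coefficients: k ↦ coefficient of q^k.
Series : Set
Series = ℕ → ℤ

Σ< : ℕ → (ℕ → ℤ) → ℤ
Σ< zero    f = + 0
Σ< (suc n) f = Σ< n f + f n

Σ≤ : ℕ → (ℕ → ℤ) → ℤ
Σ≤ k f = Σ< (suc k) f

zeroS : Series
zeroS _ = + 0

oneS : Series
oneS k = if k ≡ᵇ 0 then + 1 else + 0

qpow : ℕ → Series
qpow m k = if k ≡ᵇ m then + 1 else + 0

_⊕_ : Series → Series → Series
(f ⊕ g) k = f k + g k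

_⊖_ : Series → Series → Series
(f ⊖ g) k = f k - g k

_·_ : ℤ → Series → Series
(c · f) k = c * f k

_⊛_ : Series → Series → Series
(f ⊛ g) k = Σ≤ k (λ i → f i * g (k ℕ.∸ i))

poch : ℕ → ℕ → Series
poch a zero    = oneS
poch a (suc n) = poch a n ⊛ (oneS ⊖ qpow (a ℕ.+ n))

-- (q; q)_∞ : the coefficient of q^k equals that of the finite product
-- (q;q)_{k+1}, since factors (1 - q^j) with j > k do not affect it.
qInf : Series
qInf k = poch 1 (suc k) k

-- Multiplicative inverse of a series with constant term 1.
-- invUpTo f k j = j-th inverse coefficient for j ≤ k (0 beyond).
invUpTo : Series → ℕ → Series
invUpTo f zero j = if j ≡ᵇ 0 then + 1 else + 0
invUpTo f (suc k) j =
  if j ≤ᵇ k then invUpTo f k j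
  else (if j ≡ᵇ suc k
        then - Σ< (suc k) (λ i → f (suc i) * invUpTo f k (k ℕ.∸ i))
        else + 0)

inv : Series → Series
inv f k = invUpTo f k k

qbinom : ℕ → ℕ → Series
qbinom N n = if n ≤ᵇ N
  then poch 1 N ⊛ inv (poch 1 (N ℕ.∸ n) ⊛ poch 1 n)
  else zeroS

-- A family of series F n sums (q-adically, i.e. coefficientwise
-- eventually stable partial sums) to S.
HasSum : (ℕ → Series) → Series → Set
HasSum F S = ∀ k → ∃[ M ] (∀ m → M ≤ m → Σ< m (λ n → F n k) ≡ S k)

lhsTerm : ℕ → ℕ → Series
lhsTerm N n = (qInf ⊛ inv (poch 1 n)) ⊛ (poch (suc n) N ⊖ oneS)

rhsTerm : ℕ → ℕ → Series
rhsTerm N zero = zeroS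
rhsTerm N n@(suc _) =
  ((- + 1) ^ n) · (qbinom N n ⊛ (qpow ((n ℕ.* suc n) / 2)
                   ⊛ (poch 1 n ⊛ inv (oneS ⊖ qpow n))))

module Submission where

-- Let Tail n = (q)_∞/(q)_n = (q^{n+1})_∞ and let gauss N k be the Gaussian
-- polynomial [N, k], defined by the q-Pascal rule.  Three facts combine.
--  (1) The finite q-binomial theorem (q^a)_N = Σ_{k ≤ N} (-1)^k [N, k] q^{ka + k(k-1)/2}
--      (q-binomial); with a = n+1 it writes the n-th left summand as
--      Tail n · Σ_{k<N} coeff k q^{n(k+1)},  coeff k = (-1)^{k+1} [N, k+1] q^{(k+1)(k+2)/2}.
--  (2) The Euler-type identity Σ_n q^{nk} Tail n = (q)_{k-1} for k ≥ 1
--      (euler-qPoch), from the telescoping sum Σ_n q^n Tail n = 1 and the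
--      recursion euler (k+1) = (1 - q^k) euler k.
--  (3) gauss agrees with the frozen qbinom N k = (q)_N / ((q)_{N-k} (q)_k)
--      (qbinom-gauss), and (q)_k / (1 - q^k) = (q)_{k-1}.

open import Defs
open import Data.Nat as ℕ using (ℕ; zero; suc; _≤_; _<_; z≤n; s≤s; _∸_; _≤ᵇ_; _≡ᵇ_)
import Data.Nat.Properties as ℕP
open import Data.Nat.DivMod using (_/_; m*n/n≡m)
open import Data.Integer as ℤ using (ℤ; +_; -_; _+_; _*_; _-_)
import Data.Integer.Properties as ℤP
open import Data.Integer.Tactic.RingSolver using (solve-∀)
import Data.Nat.Tactic.RingSolver as ℕSolver
open import Data.Product using (∃-syntax; _×_; _,_)
open import Data.Sum using (inj₁; inj₂)
open import Data.Bool using (Bool; true; false; T; if_then_else_)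
open import Data.Unit using (tt)
open import Data.Empty using (⊥-elim)
open import Relation.Nullary using (¬_; yes; no)
open import Relation.Binary.PropositionalEquality
open import Function using (_∘_)
open import Data.Maybe using (Maybe; just; nothing)
open import Level using (0ℓ)
open import Algebra.Bundles using (CommutativeRing)
open import Algebra.Solver.Ring.AlmostCommutativeRing using (fromCommutativeRing; _-Raw-AlmostCommutative⟶_)
import Algebra.Solver.Ring as RingSolver
import Relation.Binary.Reasoning.Setoid as SetoidReasoning

Σ-cong : ∀ n {f g : ℕ → ℤ} → (∀ i → i < n → f i ≡ g i) → Σ< n f ≡ Σ< n g
Σ-cong zero    h = refl
Σ-cong (suc n) h = cong₂ _+_ (Σ-cong n (λ i i<n → h i (ℕP.m<n⇒m<1+n i<n))) (h n ℕP.≤-refl)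

Σ-cong′ : ∀ n {f g : ℕ → ℤ} → (∀ i → f i ≡ g i) → Σ< n f ≡ Σ< n g
Σ-cong′ n h = Σ-cong n (λ i _ → h i)

Σ-+ : ∀ n (f g : ℕ → ℤ) → Σ< n (λ i → f i + g i) ≡ Σ< n f + Σ< n g
Σ-+ zero    f g = refl
Σ-+ (suc n) f g rewrite Σ-+ n f g = interchange (Σ< n f) (Σ< n g) (f n) (g n)
  where
  interchange : ∀ a b c d → (a + b) + (c + d) ≡ (a + c) + (b + d)
  interchange = solve-∀

Σ-*ˡ : ∀ n c (f : ℕ → ℤ) → Σ< n (λ i → c * f i) ≡ c * Σ< n f
Σ-*ˡ zero    c f = sym (ℤP.*-zeroʳ c)
Σ-*ˡ (suc n) c f rewrite Σ-*ˡ n c f = sym (ℤP.*-distribˡ-+ c (Σ< n f) (f n))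

Σ-*ʳ : ∀ n c (f : ℕ → ℤ) → Σ< n (λ i → f i * c) ≡ Σ< n f * c
Σ-*ʳ n c f = trans (Σ-cong′ n (λ i → ℤP.*-comm (f i) c)) (trans (Σ-*ˡ n c f) (ℤP.*-comm c _))

Σ-neg : ∀ n (f : ℕ → ℤ) → Σ< n (λ i → - f i) ≡ - Σ< n f
Σ-neg zero    f = refl
Σ-neg (suc n) f rewrite Σ-neg n f = sym (ℤP.neg-distrib-+ (Σ< n f) (f n))

Σ-zero : ∀ n {f : ℕ → ℤ} → (∀ i → i < n → f i ≡ + 0) → Σ< n f ≡ + 0
Σ-zero zero    h = refl
Σ-zero (suc n) h rewrite Σ-zero n (λ i i<n → h i (ℕP.m<n⇒m<1+n i<n)) | h n ℕP.≤-refl = refl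

Σ-head : ∀ n (f : ℕ → ℤ) → Σ< (suc n) f ≡ f 0 + Σ< n (λ i → f (suc i))
Σ-head zero    f = ℤP.+-comm (+ 0) (f 0)
Σ-head (suc n) f rewrite Σ-head n f = ℤP.+-assoc (f 0) _ _

Σ-extend : ∀ m n {f : ℕ → ℤ} → m ≤ n → (∀ i → m ≤ i → i < n → f i ≡ + 0) → Σ< n f ≡ Σ< m f
Σ-extend m zero    z≤n h = refl
Σ-extend m (suc n) m≤1+n h with ℕP.m≤n⇒m<n∨m≡n m≤1+n
... | inj₂ refl = refl
... | inj₁ m<1+n = trans (cong₂ _+_ (Σ-extend m n m≤n (λ i m≤i i<n → h i m≤i (ℕP.m<n⇒m<1+n i<n)))
                                     (h n m≤n ℕP.≤-refl))
                         (ℤP.+-identityʳ _)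
  where
  m≤n : m ≤ n
  m≤n = ℕP.≤-pred m<1+n

Σ-swap : ∀ m n (f : ℕ → ℕ → ℤ) →
  Σ< m (λ i → Σ< n (λ j → f i j)) ≡ Σ< n (λ j → Σ< m (λ i → f i j))
Σ-swap zero    n f = sym (Σ-zero n (λ _ _ → refl))
Σ-swap (suc m) n f rewrite Σ-swap m n f = sym (Σ-+ n (λ j → Σ< m (λ i → f i j)) (λ j → f m j))

Σ-reverse : ∀ k (f : ℕ → ℤ) → Σ≤ k (λ i → f (k ∸ i)) ≡ Σ≤ k f
Σ-reverse zero    f = refl
Σ-reverse (suc k) f = begin
  Σ≤ (suc k) (λ i → f (suc k ∸ i))   ≡⟨ Σ-head (suc k) _ ⟩
  f (suc k) + Σ≤ k (λ i → f (k ∸ i)) ≡⟨ cong (λ s → f (suc k) + s) (Σ-reverse k f) ⟩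
  f (suc k) + Σ≤ k f                 ≡⟨ ℤP.+-comm (f (suc k)) _ ⟩
  Σ≤ (suc k) f                       ∎
  where open ≡-Reasoning

Σ-triangle : ∀ k (F : ℕ → ℕ → ℤ) →
  Σ≤ k (λ i → Σ≤ i (λ j → F i j)) ≡ Σ≤ k (λ j → Σ≤ (k ∸ j) (λ l → F (j ℕ.+ l) j))
Σ-triangle zero    F = refl
Σ-triangle (suc k) F = begin
  Σ≤ (suc k) (λ i → Σ≤ i (λ j → F i j))
    ≡⟨ Σ-cong′ (suc (suc k)) (λ i → Σ-head i (F i)) ⟩
  Σ≤ (suc k) (λ i → F i 0 + Σ< i (λ j → F i (suc j)))
    ≡⟨ Σ-+ (suc (suc k)) _ _ ⟩
  column₀ + Σ≤ (suc k) (λ i → Σ< i (λ j → F i (suc j)))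
    ≡⟨ cong (λ s → column₀ + s) (trans (Σ-head (suc k) _) (ℤP.+-identityˡ _)) ⟩
  column₀ + Σ≤ k (λ i → Σ≤ i (λ j → F (suc i) (suc j)))
    ≡⟨ cong (λ s → column₀ + s) (Σ-triangle k (λ i j → F (suc i) (suc j))) ⟩
  column₀ + Σ≤ k (λ j → Σ≤ (k ∸ j) (λ l → F (suc (j ℕ.+ l)) (suc j)))
    ≡⟨ sym (Σ-head (suc k) _) ⟩
  Σ≤ (suc k) (λ j → Σ≤ (suc k ∸ j) (λ l → F (j ℕ.+ l) j)) ∎
  where
  open ≡-Reasoning
  column₀ : ℤ
  column₀ = Σ≤ (suc k) (λ i → F i 0)

infix 4 _≈_
_≈_ : Series → Series → Set
f ≈ g = ∀ k → f k ≡ g k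

⊝_ : Series → Series
(⊝ f) k = - f k

⊛-cong : ∀ {f f′ g g′} → f ≈ f′ → g ≈ g′ → (f ⊛ g) ≈ (f′ ⊛ g′)
⊛-cong f≈f′ g≈g′ k = Σ-cong′ (suc k) (λ i → cong₂ _*_ (f≈f′ i) (g≈g′ (k ∸ i)))

⊛-congˡ : ∀ f {g g′} → g ≈ g′ → (f ⊛ g) ≈ (f ⊛ g′)
⊛-congˡ f g≈g′ = ⊛-cong {f} {f} (λ _ → refl) g≈g′

⊛-congʳ : ∀ g {f f′} → f ≈ f′ → (f ⊛ g) ≈ (f′ ⊛ g)
⊛-congʳ g f≈f′ = ⊛-cong {g = g} {g} f≈f′ (λ _ → refl)

⊛-comm : ∀ f g → (f ⊛ g) ≈ (g ⊛ f)
⊛-comm f g k = begin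
  Σ≤ k (λ i → f i * g (k ∸ i))                   ≡⟨ sym (Σ-reverse k _) ⟩
  Σ≤ k (λ i → f (k ∸ i) * g (k ∸ (k ∸ i)))       ≡⟨ Σ-cong (suc k) swap ⟩
  Σ≤ k (λ i → g i * f (k ∸ i))                   ∎
  where
  open ≡-Reasoning
  swap : ∀ i → i < suc k → f (k ∸ i) * g (k ∸ (k ∸ i)) ≡ g i * f (k ∸ i)
  swap i i≤k = trans (ℤP.*-comm (f (k ∸ i)) _)
                     (cong (λ j → g j * f (k ∸ i)) (ℕP.m∸[m∸n]≡n (ℕP.≤-pred i≤k)))

⊛-assoc : ∀ f g h → ((f ⊛ g) ⊛ h) ≈ (f ⊛ (g ⊛ h))
⊛-assoc f g h k = begin
  Σ≤ k (λ i → Σ≤ i (λ j → f j * g (i ∸ j)) * h (k ∸ i))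
    ≡⟨ Σ-cong′ (suc k) (λ i → sym (Σ-*ʳ (suc i) (h (k ∸ i)) _)) ⟩
  Σ≤ k (λ i → Σ≤ i (λ j → f j * g (i ∸ j) * h (k ∸ i)))
    ≡⟨ Σ-triangle k _ ⟩
  Σ≤ k (λ j → Σ≤ (k ∸ j) (λ l → f j * g (j ℕ.+ l ∸ j) * h (k ∸ (j ℕ.+ l))))
    ≡⟨ Σ-cong′ (suc k) (λ j → Σ-cong′ (suc (k ∸ j)) (reindex j)) ⟩
  Σ≤ k (λ j → Σ≤ (k ∸ j) (λ l → f j * (g l * h (k ∸ j ∸ l))))
    ≡⟨ Σ-cong′ (suc k) (λ j → Σ-*ˡ (suc (k ∸ j)) (f j) _) ⟩
  Σ≤ k (λ j → f j * Σ≤ (k ∸ j) (λ l → g l * h (k ∸ j ∸ l))) ∎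
  where
  open ≡-Reasoning
  reindex : ∀ j l → f j * g (j ℕ.+ l ∸ j) * h (k ∸ (j ℕ.+ l)) ≡ f j * (g l * h (k ∸ j ∸ l))
  reindex j l = trans (ℤP.*-assoc (f j) _ _)
    (cong₂ (λ a b → f j * (g a * h b)) (ℕP.m+n∸m≡n j l) (sym (ℕP.∸-+-assoc k j l)))

⊛-identityˡ : ∀ f → (oneS ⊛ f) ≈ f
⊛-identityˡ f k = begin
  Σ≤ k (λ i → oneS i * f (k ∸ i))               ≡⟨ Σ-head k _ ⟩
  + 1 * f k + Σ< k (λ i → + 0 * f (k ∸ suc i))   ≡⟨ cong₂ _+_ (ℤP.*-identityˡ (f k)) (Σ-zero k (λ _ _ → refl)) ⟩
  f k + + 0                                      ≡⟨ ℤP.+-identityʳ (f k) ⟩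
  f k                                            ∎
  where open ≡-Reasoning

⊛-distribˡ : ∀ f g h → (f ⊛ (g ⊕ h)) ≈ ((f ⊛ g) ⊕ (f ⊛ h))
⊛-distribˡ f g h k =
  trans (Σ-cong′ (suc k) (λ i → ℤP.*-distribˡ-+ (f i) (g (k ∸ i)) (h (k ∸ i)))) (Σ-+ (suc k) _ _)

·-⊛ : ∀ c f g → ((c · f) ⊛ g) ≈ (c · (f ⊛ g))
·-⊛ c f g k = trans (Σ-cong′ (suc k) (λ i → ℤP.*-assoc c (f i) _)) (Σ-*ˡ (suc k) c _)

SeriesRing : CommutativeRing 0ℓ 0ℓ
SeriesRing = record
  { Carrier = Series ; _≈_ = _≈_ ; _+_ = _⊕_ ; _*_ = _⊛_ ; -_ = ⊝_ ; 0# = zeroS ; 1# = oneS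
  ; isCommutativeRing = record
    { isRing = record
      { +-isAbelianGroup = record
        { isGroup = record
          { isMonoid = record
            { isSemigroup = record
              { isMagma = record
                { isEquivalence = record
                  { refl = λ _ → refl ; sym = λ p k → sym (p k) ; trans = λ p q k → trans (p k) (q k) }
                ; ∙-cong = λ p q k → cong₂ _+_ (p k) (q k) }
              ; assoc = λ f g h k → ℤP.+-assoc (f k) (g k) (h k) }
            ; identity = (λ f k → ℤP.+-identityˡ (f k)) , (λ f k → ℤP.+-identityʳ (f k)) }
          ; inverse = (λ f k → ℤP.+-inverseˡ (f k)) , (λ f k → ℤP.+-inverseʳ (f k))
          ; ⁻¹-cong = λ p k → cong -_ (p k) }
        ; comm = λ f g k → ℤP.+-comm (f k) (g k) }
      ; *-cong = ⊛-cong
      ; *-assoc = ⊛-assoc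
      ; *-identity = ⊛-identityˡ , (λ f k → trans (⊛-comm f oneS k) (⊛-identityˡ f k))
      ; distrib = ⊛-distribˡ , (λ f g h k → trans (⊛-comm (g ⊕ h) f k) (trans (⊛-distribˡ f g h k)
                     (cong₂ _+_ (⊛-comm f g k) (⊛-comm f h k)))) }
    ; *-comm = ⊛-comm } }

open CommutativeRing SeriesRing using ()
  renaming ( refl to ≈-refl; sym to ≈-sym; trans to ≈-trans
           ; *-identityʳ to ⊛-identityʳ
           ; distribʳ to ⊛-distribʳ; zeroˡ to ⊛-zeroˡ; zeroʳ to ⊛-zeroʳ; setoid to seriesSetoid )

module ≈-Reasoning = SetoidReasoning seriesSetoid

⊕-cong : ∀ {a b c d} → a ≈ b → c ≈ d → (a ⊕ c) ≈ (b ⊕ d)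
⊕-cong p q k = cong₂ _+_ (p k) (q k)

⊖-cong : ∀ {a b c d} → a ≈ b → c ≈ d → (a ⊖ c) ≈ (b ⊖ d)
⊖-cong p q k = cong₂ _-_ (p k) (q k)

constant : ℤ → Series
constant c k = if k ≡ᵇ 0 then c else + 0

constant≈ : ∀ c → constant c ≈ (c · oneS)
constant≈ c zero    = sym (ℤP.*-identityʳ c)
constant≈ c (suc k) = sym (ℤP.*-zeroʳ c)

·≈constant⊛ : ∀ c f → (c · f) ≈ (constant c ⊛ f)
·≈constant⊛ c f k = sym (begin
  (constant c ⊛ f) k  ≡⟨ ⊛-congʳ f (constant≈ c) k ⟩
  ((c · oneS) ⊛ f) k  ≡⟨ ·-⊛ c oneS f k ⟩
  c * (oneS ⊛ f) k    ≡⟨ cong (c *_) (⊛-identityˡ f k) ⟩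
  c * f k             ∎)
  where open ≡-Reasoning

constant-* : ∀ c d → constant (c * d) ≈ (constant c ⊛ constant d)
constant-* c d k = begin
  constant (c * d) k  ≡⟨ constant≈ (c * d) k ⟩
  c * d * oneS k      ≡⟨ ℤP.*-assoc c d (oneS k) ⟩
  c * (d * oneS k)    ≡⟨ cong (c *_) (sym (constant≈ d k)) ⟩
  c * constant d k    ≡⟨ ·≈constant⊛ c (constant d) k ⟩
  (constant c ⊛ constant d) k ∎
  where open ≡-Reasoning

constant-morphism : ℤ.+-*-rawRing -Raw-AlmostCommutative⟶ fromCommutativeRing SeriesRing
constant-morphism = record
  { ⟦_⟧ = constant
  ; +-homo = λ c d → λ { zero → refl ; (suc k) → refl }
  ; *-homo = constant-*
  ; -‿homo = λ c → λ { zero → refl ; (suc k) → refl }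
  ; 0-homo = λ { zero → refl ; (suc k) → refl }
  ; 1-homo = λ k → refl }

constant-≟ : ∀ a b → Maybe (constant a ≈ constant b)
constant-≟ a b with a ℤ.≟ b
... | yes refl = just (λ _ → refl)
... | no _     = nothing

open RingSolver ℤ.+-*-rawRing (fromCommutativeRing SeriesRing) constant-morphism constant-≟
  using (solve; _:=_; con; _:+_; _:*_; :-_; _:-_)

if-true : ∀ {A : Set} {b : Bool} {x y : A} → T b → (if b then x else y) ≡ x
if-true {b = true} _ = refl

if-false : ∀ {A : Set} {b : Bool} {x y : A} → ¬ T b → (if b then x else y) ≡ y
if-false {b = false} _   = refl
if-false {b = true}  ¬tt = ⊥-elim (¬tt tt)

qpow-≡ : ∀ a → qpow a a ≡ + 1
qpow-≡ a = if-true (ℕP.≡⇒≡ᵇ a a refl)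

qpow-≢ : ∀ a i → i ≢ a → qpow a i ≡ + 0
qpow-≢ a i i≢a = if-false (λ i≡ᵇa → i≢a (ℕP.≡ᵇ⇒≡ i a i≡ᵇa))

qpow-cong : ∀ {a b} → a ≡ b → qpow a ≈ qpow b
qpow-cong refl = ≈-refl

Σ-qpow : ∀ n a (g : ℕ → ℤ) → a < n → Σ< n (λ i → qpow a i * g i) ≡ g a
Σ-qpow (suc n) a g a<1+n with ℕP.m≤n⇒m<n∨m≡n (ℕP.≤-pred a<1+n)
... | inj₁ a<n = trans (cong₂ _+_ (Σ-qpow n a g a<n) (cong (_* g n) (qpow-≢ a n (ℕP.>⇒≢ a<n))))
                       (ℤP.+-identityʳ _)
... | inj₂ refl = trans (cong₂ _+_ (Σ-zero n below) (cong (_* g n) (qpow-≡ n)))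
                        (trans (ℤP.+-identityˡ _) (ℤP.*-identityˡ _))
  where
  below : ∀ i → i < n → qpow n i * g i ≡ + 0
  below i i<n = cong (_* g i) (qpow-≢ n i (ℕP.<⇒≢ i<n))

-- q-adic order: Ord≥ m X says that q^m divides X, i.e. the coefficients
-- of X below q^m vanish.  It is closed under the ring operations.

Ord≥ : ℕ → Series → Set
Ord≥ m X = ∀ j → j < m → X j ≡ + 0

Ord≥-mono : ∀ {m m′ X} → m′ ≤ m → Ord≥ m X → Ord≥ m′ X
Ord≥-mono m′≤m o j j<m′ = o j (ℕP.<-≤-trans j<m′ m′≤m)

Ord≥-cong : ∀ {m X Y} → X ≈ Y → Ord≥ m X → Ord≥ m Y
Ord≥-cong X≈Y o j j<m = trans (sym (X≈Y j)) (o j j<m)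

Ord≥-⊕ : ∀ {m X Y} → Ord≥ m X → Ord≥ m Y → Ord≥ m (X ⊕ Y)
Ord≥-⊕ o p j j<m rewrite o j j<m | p j j<m = refl

Ord≥-⊝ : ∀ {m X} → Ord≥ m X → Ord≥ m (⊝ X)
Ord≥-⊝ o j j<m rewrite o j j<m = refl

Ord≥-⊛ʳ : ∀ {m} f {g} → Ord≥ m g → Ord≥ m (f ⊛ g)
Ord≥-⊛ʳ f o j j<m = Σ-zero (suc j) (λ i _ →
  trans (cong (f i *_) (o (j ∸ i) (ℕP.≤-<-trans (ℕP.m∸n≤m j i) j<m))) (ℤP.*-zeroʳ (f i)))

Ord≥-⊛ˡ : ∀ {m f} g → Ord≥ m f → Ord≥ m (f ⊛ g)
Ord≥-⊛ˡ {f = f} g o = Ord≥-cong (⊛-comm g f) (Ord≥-⊛ʳ g o)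

Ord≥-qpow : ∀ a → Ord≥ a (qpow a)
Ord≥-qpow a j j<a = qpow-≢ a j (ℕP.<⇒≢ j<a)

qpow-shift : ∀ a f j → (qpow a ⊛ f) (a ℕ.+ j) ≡ f j
qpow-shift a f j = trans (Σ-qpow (suc (a ℕ.+ j)) a _ (s≤s (ℕP.m≤m+n a j))) (cong f (ℕP.m+n∸m≡n a j))

qpow-+ : ∀ a b → (qpow a ⊛ qpow b) ≈ qpow (a ℕ.+ b)
qpow-+ a b k with ℕP.<-≤-connex k a
... | inj₁ k<a = trans (Ord≥-⊛ˡ (qpow b) (Ord≥-qpow a) k k<a)
                       (sym (Ord≥-qpow (a ℕ.+ b) k (ℕP.<-≤-trans k<a (ℕP.m≤m+n a b))))
... | inj₂ a≤k = subst (λ t → (qpow a ⊛ qpow b) t ≡ qpow (a ℕ.+ b) t) (ℕP.m+[n∸m]≡n a≤k)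
                       (trans (qpow-shift a (qpow b) (k ∸ a)) (shifted (k ∸ a)))
  where
  shifted : ∀ j → qpow b j ≡ qpow (a ℕ.+ b) (a ℕ.+ j)
  shifted j with j ℕ.≟ b
  ... | yes refl = trans (qpow-≡ j) (sym (qpow-≡ (a ℕ.+ j)))
  ... | no j≢b   = trans (qpow-≢ b j j≢b) (sym (qpow-≢ (a ℕ.+ b) (a ℕ.+ j) (j≢b ∘ ℕP.+-cancelˡ-≡ a j b)))

⊛-at-0 : ∀ f g → (f ⊛ g) 0 ≡ f 0 * g 0
⊛-at-0 f g = ℤP.+-identityˡ _

invUpTo-stable : ∀ f k j → j ≤ k → invUpTo f k j ≡ inv f j
invUpTo-stable f zero    zero z≤n = refl
invUpTo-stable f (suc k) j j≤1+k with ℕP.m≤n⇒m<n∨m≡n j≤1+k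
... | inj₂ refl  = refl
... | inj₁ j<1+k = trans (if-true (ℕP.≤⇒≤ᵇ (ℕP.≤-pred j<1+k))) (invUpTo-stable f k j (ℕP.≤-pred j<1+k))

inv-suc : ∀ f k → inv f (suc k) ≡ - Σ< (suc k) (λ i → f (suc i) * inv f (k ∸ i))
inv-suc f k = begin
  invUpTo f (suc k) (suc k)
    ≡⟨ if-false (λ 1+k≤k → ℕP.<-irrefl refl (ℕP.≤ᵇ⇒≤ (suc k) k 1+k≤k)) ⟩
  (if suc k ≡ᵇ suc k then - Σ< (suc k) (λ i → f (suc i) * invUpTo f k (k ∸ i)) else + 0)
    ≡⟨ if-true (ℕP.≡⇒≡ᵇ k k refl) ⟩
  - Σ< (suc k) (λ i → f (suc i) * invUpTo f k (k ∸ i))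
    ≡⟨ cong -_ (Σ-cong′ (suc k) (λ i → cong (f (suc i) *_) (invUpTo-stable f k (k ∸ i) (ℕP.m∸n≤m k i)))) ⟩
  - Σ< (suc k) (λ i → f (suc i) * inv f (k ∸ i)) ∎
  where open ≡-Reasoning

inv-inverseʳ : ∀ f → f 0 ≡ + 1 → (f ⊛ inv f) ≈ oneS
inv-inverseʳ f f₀≡1 zero    = trans (⊛-at-0 f (inv f)) (cong (_* + 1) f₀≡1)
inv-inverseʳ f f₀≡1 (suc k) = begin
  (f ⊛ inv f) (suc k)         ≡⟨ Σ-head (suc k) _ ⟩
  f 0 * inv f (suc k) + S     ≡⟨ cong₂ (λ a b → a * b + S) f₀≡1 (inv-suc f k) ⟩
  + 1 * - S + S               ≡⟨ cong (_+ S) (ℤP.*-identityˡ (- S)) ⟩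
  - S + S                     ≡⟨ ℤP.+-inverseˡ S ⟩
  + 0                         ∎
  where
  open ≡-Reasoning
  S : ℤ
  S = Σ< (suc k) (λ i → f (suc i) * inv f (k ∸ i))

inv-solve : ∀ f {g h} → f 0 ≡ + 1 → (f ⊛ g) ≈ h → g ≈ (h ⊛ inv f)
inv-solve f {g} {h} f₀≡1 fg≈h = begin
  g                  ≈⟨ ≈-sym (⊛-identityʳ g) ⟩
  g ⊛ oneS           ≈⟨ ⊛-congˡ g (≈-sym (inv-inverseʳ f f₀≡1)) ⟩
  g ⊛ (f ⊛ inv f)    ≈⟨ ≈-sym (⊛-assoc g f (inv f)) ⟩
  (g ⊛ f) ⊛ inv f    ≈⟨ ⊛-congʳ (inv f) (≈-trans (⊛-comm g f) fg≈h) ⟩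
  h ⊛ inv f          ∎
  where open ≈-Reasoning

-- The q-Pochhammer symbol.  qfactor a is the factor 1 - q^a, so that
-- poch a (suc n) = poch a n ⊛ qfactor (a + n) definitionally.

qfactor : ℕ → Series
qfactor a = oneS ⊖ qpow a

⊛-qfactor : ∀ X Q → (X ⊛ (oneS ⊖ Q)) ≈ (X ⊖ (X ⊛ Q))
⊛-qfactor = solve 2 (λ X Q → X :* (con (+ 1) :- Q) := X :- (X :* Q)) ≈-refl

poch-at-0 : ∀ a n → poch (suc a) n 0 ≡ + 1
poch-at-0 a zero    = refl
poch-at-0 a (suc n) = trans (⊛-at-0 (poch (suc a) n) (qfactor (suc a ℕ.+ n))) (cong (_* + 1) (poch-at-0 a n))

poch-stable : ∀ a n j → j < a ℕ.+ n → poch a (suc n) j ≡ poch a n j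
poch-stable a n j j<a+n = trans (⊛-qfactor (poch a n) (qpow (a ℕ.+ n)) j)
  (trans (cong (λ x → poch a n j - x) (Ord≥-⊛ʳ (poch a n) (Ord≥-qpow (a ℕ.+ n)) j j<a+n)) (ℤP.+-identityʳ _))

poch-coeff : ∀ j m → j ≤ m → poch 1 m j ≡ poch 1 j j
poch-coeff zero zero z≤n = refl
poch-coeff j (suc m) j≤1+m with ℕP.m≤n⇒m<n∨m≡n j≤1+m
... | inj₂ refl  = refl
... | inj₁ j<1+m = trans (poch-stable 1 m j j<1+m) (poch-coeff j m (ℕP.≤-pred j<1+m))

qInf-coeff : ∀ n j → j ≤ n → qInf j ≡ poch 1 n j
qInf-coeff n j j≤n = trans (poch-coeff j (suc j) (ℕP.n≤1+n j)) (sym (poch-coeff j n j≤n))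

poch-Ord≥ : ∀ a N → Ord≥ (suc a) (poch (suc a) N ⊖ oneS)
poch-Ord≥ a zero    j _ = ℤP.+-inverseʳ (oneS j)
poch-Ord≥ a (suc N) = Ord≥-cong (≈-sym (expand (poch (suc a) N) (qpow (suc a ℕ.+ N))))
  (Ord≥-⊕ (Ord≥-⊛ˡ (qfactor (suc a ℕ.+ N)) (poch-Ord≥ a N))
          (Ord≥-⊝ (Ord≥-mono (ℕP.m≤m+n (suc a) N) (Ord≥-qpow (suc a ℕ.+ N)))))
  where
  expand : ∀ X Q → ((X ⊛ (oneS ⊖ Q)) ⊖ oneS) ≈ (((X ⊖ oneS) ⊛ (oneS ⊖ Q)) ⊖ Q)
  expand = solve 2 (λ X Q → (X :* (con (+ 1) :- Q)) :- con (+ 1)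
                          := ((X :- con (+ 1)) :* (con (+ 1) :- Q)) :- Q) ≈-refl

qPoch : ℕ → Series
qPoch n = poch 1 n

qPoch-at-0 : ∀ n → qPoch n 0 ≡ + 1
qPoch-at-0 = poch-at-0 0

-- The tail product Tail n = (q)_∞ / (q)_n = (q^{n+1})_∞.
Tail : ℕ → Series
Tail n = qInf ⊛ inv (qPoch n)

Tail-step : ∀ n → (qfactor (suc n) ⊛ Tail (suc n)) ≈ Tail n
Tail-step n = begin
  qfactor (suc n) ⊛ (qInf ⊛ inv D) ≈⟨ rotate (qfactor (suc n)) qInf (inv D) ⟩
  qInf ⊛ (qfactor (suc n) ⊛ inv D) ≈⟨ ⊛-congˡ qInf quotient ⟩
  qInf ⊛ (oneS ⊛ inv (qPoch n))    ≈⟨ ⊛-congˡ qInf (⊛-identityˡ (inv (qPoch n))) ⟩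
  Tail n                           ∎
  where
  open ≈-Reasoning
  D : Series
  D = qPoch n ⊛ qfactor (suc n)
  rotate : ∀ a b c → (a ⊛ (b ⊛ c)) ≈ (b ⊛ (a ⊛ c))
  rotate = solve 3 (λ a b c → a :* (b :* c) := b :* (a :* c)) ≈-refl
  quotient : (qfactor (suc n) ⊛ inv D) ≈ (oneS ⊛ inv (qPoch n))
  quotient = inv-solve (qPoch n) (qPoch-at-0 n)
    (≈-trans (≈-sym (⊛-assoc (qPoch n) (qfactor (suc n)) (inv D))) (inv-inverseʳ D (qPoch-at-0 (suc n))))

-- Tail n ≡ 1 modulo q^{n+1}, since (q)_∞ ≡ (q)_n there.
Tail-Ord≥ : ∀ n → Ord≥ (suc n) (Tail n ⊖ oneS)
Tail-Ord≥ n = Ord≥-cong (≈-sym Tail-1) (Ord≥-⊛ˡ (inv (qPoch n)) qInf≡qPoch)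
  where
  qInf≡qPoch : Ord≥ (suc n) (qInf ⊖ qPoch n)
  qInf≡qPoch j j≤n = trans (cong (_- qPoch n j) (qInf-coeff n j (ℕP.≤-pred j≤n))) (ℤP.+-inverseʳ (qPoch n j))
  factor : ∀ a p i → ((a ⊛ i) ⊖ (p ⊛ i)) ≈ ((a ⊖ p) ⊛ i)
  factor = solve 3 (λ a p i → (a :* i) :- (p :* i) := (a :- p) :* i) ≈-refl
  Tail-1 : (Tail n ⊖ oneS) ≈ ((qInf ⊖ qPoch n) ⊛ inv (qPoch n))
  Tail-1 = ≈-trans (⊖-cong {Tail n} ≈-refl (≈-sym (inv-inverseʳ (qPoch n) (qPoch-at-0 n))))
                (factor qInf (qPoch n) (inv (qPoch n)))

ΣS : ℕ → (ℕ → Series) → Series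
ΣS n H j = Σ< n (λ k → H k j)

ΣS-cong : ∀ n {H H′} → (∀ k → k < n → H k ≈ H′ k) → ΣS n H ≈ ΣS n H′
ΣS-cong n H≈H′ j = Σ-cong n (λ k k<n → H≈H′ k k<n j)

ΣS-head : ∀ n H → ΣS (suc n) H ≈ (H 0 ⊕ ΣS n (λ k → H (suc k)))
ΣS-head n H j = Σ-head n (λ k → H k j)

ΣS-⊖ : ∀ n H H′ → ΣS n (λ k → H k ⊖ H′ k) ≈ (ΣS n H ⊖ ΣS n H′)
ΣS-⊖ n H H′ j = trans (Σ-+ n (λ k → H k j) (λ k → - H′ k j)) (cong (λ x → ΣS n H j + x) (Σ-neg n (λ k → H′ k j)))

ΣS-dropLast : ∀ n H → H n ≈ zeroS → ΣS (suc n) H ≈ ΣS n H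
ΣS-dropLast n H Hₙ≈0 j = trans (cong (λ x → ΣS n H j + x) (Hₙ≈0 j)) (ℤP.+-identityʳ _)

ΣS-⊛ʳ : ∀ n H X → (ΣS n H ⊛ X) ≈ ΣS n (λ k → H k ⊛ X)
ΣS-⊛ʳ zero    H X = ⊛-zeroˡ X
ΣS-⊛ʳ (suc n) H X = ≈-trans (⊛-distribʳ X (ΣS n H) (H n)) (⊕-cong (ΣS-⊛ʳ n H X) ≈-refl)

ΣS-⊛ˡ : ∀ n H X → (X ⊛ ΣS n H) ≈ ΣS n (λ k → X ⊛ H k)
ΣS-⊛ˡ n H X = ≈-trans (⊛-comm X (ΣS n H))
                      (≈-trans (ΣS-⊛ʳ n H X) (ΣS-cong n (λ k _ → ⊛-comm (H k) X)))

-- A family is summable when its n-th term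
-- has order at least n; then the coefficient of q^j of Σ_n F n only
-- involves F 0, …, F j, and Σ∞ F is the sum in the sense of HasSum.

Summable : (ℕ → Series) → Set
Summable F = ∀ n → Ord≥ n (F n)

Σ∞ : (ℕ → Series) → Series
Σ∞ F j = Σ≤ j (λ n → F n j)

Σ∞-truncate : ∀ F → Summable F → ∀ j m → suc j ≤ m → Σ< m (λ n → F n j) ≡ Σ∞ F j
Σ∞-truncate F summable j m j<m = Σ-extend (suc j) m j<m (λ n j<n _ → summable n j j<n)

Σ∞-hasSum : ∀ F → Summable F → HasSum F (Σ∞ F)
Σ∞-hasSum F summable j = suc j , Σ∞-truncate F summable j

Σ∞-cong : ∀ {F G} → (∀ n → F n ≈ G n) → Σ∞ F ≈ Σ∞ G
Σ∞-cong F≈G j = Σ-cong′ (suc j) (λ n → F≈G n j)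

Σ∞-⊖ : ∀ F G → Σ∞ (λ n → F n ⊖ G n) ≈ (Σ∞ F ⊖ Σ∞ G)
Σ∞-⊖ F G j = trans (Σ-+ (suc j) _ _) (cong (λ x → Σ∞ F j + x) (Σ-neg (suc j) (λ n → G n j)))

Σ∞-shift : ∀ F → Summable F → F 0 ≈ zeroS → Σ∞ F ≈ Σ∞ (λ n → F (suc n))
Σ∞-shift F summable F₀≈0 j = begin
  Σ≤ j (λ n → F n j)                       ≡⟨ Σ-head j (λ n → F n j) ⟩
  F 0 j + Σ< j (λ n → F (suc n) j)         ≡⟨ cong (_+ Σ< j (λ n → F (suc n) j)) (F₀≈0 j) ⟩
  + 0 + Σ< j (λ n → F (suc n) j)           ≡⟨ ℤP.+-identityˡ _ ⟩
  Σ< j (λ n → F (suc n) j)                 ≡⟨ sym (Σ-extend j (suc j) (ℕP.n≤1+n j) vanish) ⟩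
  Σ≤ j (λ n → F (suc n) j)                 ∎
  where
  open ≡-Reasoning
  vanish : ∀ n → j ≤ n → n < suc j → F (suc n) j ≡ + 0
  vanish n j≤n _ = summable (suc n) j (s≤s j≤n)

Σ∞-⊛ : ∀ c F → Summable F → Σ∞ (λ n → c ⊛ F n) ≈ (c ⊛ Σ∞ F)
Σ∞-⊛ c F summable j = begin
  Σ≤ j (λ n → Σ≤ j (λ i → c i * F n (j ∸ i)))  ≡⟨ Σ-swap (suc j) (suc j) _ ⟩
  Σ≤ j (λ i → Σ≤ j (λ n → c i * F n (j ∸ i)))  ≡⟨ Σ-cong′ (suc j) (λ i → Σ-*ˡ (suc j) (c i) _) ⟩
  Σ≤ j (λ i → c i * Σ≤ j (λ n → F n (j ∸ i)))  ≡⟨ Σ-cong′ (suc j) (λ i → cong (c i *_) (truncate i)) ⟩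
  (c ⊛ Σ∞ F) j                                 ∎
  where
  open ≡-Reasoning
  truncate : ∀ i → Σ≤ j (λ n → F n (j ∸ i)) ≡ Σ∞ F (j ∸ i)
  truncate i = Σ∞-truncate F summable (j ∸ i) (suc j) (s≤s (ℕP.m∸n≤m j i))

Σ∞-ΣS : ∀ N (H : ℕ → ℕ → Series) → Σ∞ (λ n → ΣS N (λ k → H k n)) ≈ ΣS N (λ k → Σ∞ (H k))
Σ∞-ΣS N H j = Σ-swap (suc j) N (λ n k → H k n j)

eulerTerm : ℕ → ℕ → Series
eulerTerm k n = qpow (n ℕ.* k) ⊛ Tail n

euler : ℕ → Series
euler k = Σ∞ (eulerTerm k)

-- For k ≥ 1 the n-th term has order at least nk ≥ n.
eulerTerm-summable : ∀ k → Summable (eulerTerm (suc k))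
eulerTerm-summable k n = Ord≥-mono (ℕP.m≤m*n n (suc k)) (Ord≥-⊛ˡ (Tail n) (Ord≥-qpow (n ℕ.* suc k)))

-- Telescoping: Σ_{n ≤ m} q^n Tail n = Tail m, by Tail-step.
euler-1-partial : ∀ m → ΣS (suc m) (eulerTerm 1) ≈ Tail m
euler-1-partial zero    j = trans (ℤP.+-identityˡ _) (⊛-identityˡ (Tail 0) j)
euler-1-partial (suc m) = begin
  ΣS (suc m) (eulerTerm 1) ⊕ (qpow (suc m ℕ.* 1) ⊛ Tail (suc m))
    ≈⟨ ⊕-cong (≈-trans (euler-1-partial m) (≈-sym (Tail-step m)))
              (⊛-congʳ (Tail (suc m)) (qpow-cong (ℕP.*-identityʳ (suc m)))) ⟩
  (qfactor (suc m) ⊛ Tail (suc m)) ⊕ (qpow (suc m) ⊛ Tail (suc m))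
    ≈⟨ recombine (qpow (suc m)) (Tail (suc m)) ⟩
  Tail (suc m) ∎
  where
  open ≈-Reasoning
  recombine : ∀ Q X → (((oneS ⊖ Q) ⊛ X) ⊕ (Q ⊛ X)) ≈ X
  recombine = solve 2 (λ Q X → ((con (+ 1) :- Q) :* X) :+ (Q :* X) := X) ≈-refl

-- Coefficient j only sees the terms n ≤ j, and Tail j ≡ 1 modulo q^{j+1}.
euler-1 : euler 1 ≈ oneS
euler-1 j = trans (euler-1-partial j j) (ℤP.i-j≡0⇒i≡j (Tail j j) (oneS j) (Tail-Ord≥ j j ℕP.≤-refl))

-- euler (k+1) - euler (k+2) = q^{k+1} euler (k+1): the difference of the
-- n-th terms is q^{n(k+1)} (1 - q^n) Tail n, which vanishes for n = 0 and
-- equals q^{k+1} eulerTerm (k+1) (n-1) otherwise.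
euler-step : ∀ k → euler (suc (suc k)) ≈ (qfactor (suc k) ⊛ euler (suc k))
euler-step k = begin
  E₂                          ≈⟨ subtractTwice E₁ E₂ ⟩
  E₁ ⊖ (E₁ ⊖ E₂)              ≈⟨ ⊖-cong {E₁} ≈-refl difference ⟩
  E₁ ⊖ (qpow (suc k) ⊛ E₁)    ≈⟨ ≈-sym (⊛-qfactor′ (qpow (suc k)) E₁) ⟩
  qfactor (suc k) ⊛ E₁        ∎
  where
  open ≈-Reasoning
  E₁ E₂ : Series
  E₁ = euler (suc k)
  E₂ = euler (suc (suc k))
  subtractTwice : ∀ a b → b ≈ (a ⊖ (a ⊖ b))
  subtractTwice = solve 2 (λ a b → b := a :- (a :- b)) ≈-refl
  ⊛-qfactor′ : ∀ Q a → ((oneS ⊖ Q) ⊛ a) ≈ (a ⊖ (Q ⊛ a))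
  ⊛-qfactor′ = solve 2 (λ Q a → (con (+ 1) :- Q) :* a := a :- (Q :* a)) ≈-refl
  factorOut : ∀ a b t → ((a ⊛ t) ⊖ ((b ⊛ a) ⊛ t)) ≈ (a ⊛ ((oneS ⊖ b) ⊛ t))
  factorOut = solve 3 (λ a b t → (a :* t) :- ((b :* a) :* t) := a :* ((con (+ 1) :- b) :* t)) ≈-refl

  D : ℕ → Series
  D n = eulerTerm (suc k) n ⊖ eulerTerm (suc (suc k)) n

  D-summable : Summable D
  D-summable n = Ord≥-⊕ (eulerTerm-summable k n) (Ord≥-⊝ (eulerTerm-summable (suc k) n))

  D-suc : ∀ m → D (suc m) ≈ (qpow (suc k) ⊛ eulerTerm (suc k) m)
  D-suc m = begin
    D (suc m)
      ≈⟨ ⊖-cong {a ⊛ Tail (suc m)} ≈-refl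
           (⊛-congʳ (Tail (suc m)) (≈-trans (qpow-cong (ℕP.*-suc (suc m) (suc k))) (≈-sym (qpow-+ (suc m) _)))) ⟩
    (a ⊛ Tail (suc m)) ⊖ ((qpow (suc m) ⊛ a) ⊛ Tail (suc m))  ≈⟨ factorOut a (qpow (suc m)) (Tail (suc m)) ⟩
    a ⊛ (qfactor (suc m) ⊛ Tail (suc m))                      ≈⟨ ⊛-congˡ a (Tail-step m) ⟩
    a ⊛ Tail m                                                ≈⟨ ⊛-congʳ (Tail m) (≈-sym (qpow-+ (suc k) (m ℕ.* suc k))) ⟩
    (qpow (suc k) ⊛ qpow (m ℕ.* suc k)) ⊛ Tail m              ≈⟨ ⊛-assoc (qpow (suc k)) (qpow (m ℕ.* suc k)) (Tail m) ⟩
    qpow (suc k) ⊛ eulerTerm (suc k) m                        ∎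
    where
    a : Series
    a = qpow (suc m ℕ.* suc k)

  difference : (E₁ ⊖ E₂) ≈ (qpow (suc k) ⊛ E₁)
  difference = begin
    E₁ ⊖ E₂                                         ≈⟨ ≈-sym (Σ∞-⊖ (eulerTerm (suc k)) (eulerTerm (suc (suc k)))) ⟩
    Σ∞ D                                            ≈⟨ Σ∞-shift D D-summable (λ j → ℤP.+-inverseʳ (eulerTerm (suc k) 0 j)) ⟩
    Σ∞ (λ m → D (suc m))                            ≈⟨ Σ∞-cong D-suc ⟩
    Σ∞ (λ m → qpow (suc k) ⊛ eulerTerm (suc k) m)   ≈⟨ Σ∞-⊛ (qpow (suc k)) (eulerTerm (suc k)) (eulerTerm-summable k) ⟩
    qpow (suc k) ⊛ E₁                               ∎

euler-qPoch : ∀ k → euler (suc k) ≈ qPoch k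
euler-qPoch zero    = euler-1
euler-qPoch (suc k) = begin
  euler (suc (suc k))               ≈⟨ euler-step k ⟩
  qfactor (suc k) ⊛ euler (suc k)   ≈⟨ ⊛-congˡ (qfactor (suc k)) (euler-qPoch k) ⟩
  qfactor (suc k) ⊛ qPoch k         ≈⟨ ⊛-comm (qfactor (suc k)) (qPoch k) ⟩
  qPoch (suc k)                     ∎
  where open ≈-Reasoning

gauss : ℕ → ℕ → Series
gauss zero    zero    = oneS
gauss zero    (suc k) = zeroS
gauss (suc N) zero    = oneS
gauss (suc N) (suc k) = gauss N (suc k) ⊕ (qpow (N ∸ k) ⊛ gauss N k)

gauss-0 : ∀ N → gauss N 0 ≈ oneS
gauss-0 zero    = ≈-refl
gauss-0 (suc N) = ≈-refl

gauss-above : ∀ N k → N < k → gauss N k ≈ zeroS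
gauss-above zero    (suc k) _           = ≈-refl
gauss-above (suc N) (suc k) (s≤s N<k) =
  ⊕-cong (gauss-above N (suc k) (ℕP.m<n⇒m<1+n N<k))
         (≈-trans (⊛-congˡ (qpow (N ∸ k)) (gauss-above N k N<k)) (⊛-zeroʳ (qpow (N ∸ k))))

gauss-factorial : ∀ N k → k ≤ N → (gauss N k ⊛ (qPoch (N ∸ k) ⊛ qPoch k)) ≈ qPoch N
gauss-factorial zero    zero z≤n = λ j → trans (⊛-identityˡ (oneS ⊛ oneS) j) (⊛-identityˡ oneS j)
gauss-factorial (suc N) zero z≤n = λ j → trans (⊛-identityˡ (qPoch (suc N) ⊛ oneS) j) (⊛-identityʳ (qPoch (suc N)) j)
gauss-factorial (suc N) (suc k) (s≤s k≤N) = begin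
  (gauss N (suc k) ⊕ (Q ⊛ gauss N k)) ⊛ (qPoch (N ∸ k) ⊛ qPoch (suc k))
    ≈⟨ ⊛-distribʳ (qPoch (N ∸ k) ⊛ qPoch (suc k)) (gauss N (suc k)) (Q ⊛ gauss N k) ⟩
  (gauss N (suc k) ⊛ (qPoch (N ∸ k) ⊛ qPoch (suc k))) ⊕ ((Q ⊛ gauss N k) ⊛ (qPoch (N ∸ k) ⊛ qPoch (suc k)))
    ≈⟨ ⊕-cong first second ⟩
  (qPoch N ⊛ qfactor (N ∸ k)) ⊕ (Q ⊛ (qPoch N ⊛ qfactor (suc k)))
    ≈⟨ combine (qPoch N) Q (qpow (suc k)) ⟩
  qPoch N ⊛ (oneS ⊖ (Q ⊛ qpow (suc k)))
    ≈⟨ ⊛-congˡ (qPoch N) (⊖-cong {oneS} ≈-refl (≈-trans (qpow-+ (N ∸ k) (suc k)) (qpow-cong N-k+1+k))) ⟩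
  qPoch (suc N) ∎
  where
  open ≈-Reasoning
  Q : Series
  Q = qpow (N ∸ k)
  N-k+1+k : N ∸ k ℕ.+ suc k ≡ suc N
  N-k+1+k = trans (ℕP.+-suc (N ∸ k) k) (cong suc (ℕP.m∸n+n≡m k≤N))
  combine : ∀ p a b → ((p ⊛ (oneS ⊖ a)) ⊕ (a ⊛ (p ⊛ (oneS ⊖ b)))) ≈ (p ⊛ (oneS ⊖ (a ⊛ b)))
  combine = solve 3 (λ p a b → (p :* (con (+ 1) :- a)) :+ (a :* (p :* (con (+ 1) :- b)))
                             := p :* (con (+ 1) :- (a :* b))) ≈-refl
  regroup₂ : ∀ a g x y z → ((a ⊛ g) ⊛ (x ⊛ (y ⊛ z))) ≈ (a ⊛ ((g ⊛ (x ⊛ y)) ⊛ z))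
  regroup₂ = solve 5 (λ a g x y z → (a :* g) :* (x :* (y :* z)) := a :* ((g :* (x :* y)) :* z)) ≈-refl
  regroup₁ : ∀ g x y z → (g ⊛ ((x ⊛ y) ⊛ z)) ≈ ((g ⊛ (x ⊛ z)) ⊛ y)
  regroup₁ = solve 4 (λ g x y z → g :* ((x :* y) :* z) := (g :* (x :* z)) :* y) ≈-refl

  second : ((Q ⊛ gauss N k) ⊛ (qPoch (N ∸ k) ⊛ qPoch (suc k))) ≈ (Q ⊛ (qPoch N ⊛ qfactor (suc k)))
  second = ≈-trans (regroup₂ Q (gauss N k) (qPoch (N ∸ k)) (qPoch k) (qfactor (suc k)))
                   (⊛-congˡ Q (⊛-congʳ (qfactor (suc k)) (gauss-factorial N k k≤N)))

  -- [N, k+1] (q)_{N-k} (q)_{k+1} = (q)_N (1 - q^{N-k}): both sides vanish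
  -- when k = N, and otherwise (q)_{N-k} = (q)_{N-k-1} (1 - q^{N-k}).
  first : (gauss N (suc k) ⊛ (qPoch (N ∸ k) ⊛ qPoch (suc k))) ≈ (qPoch N ⊛ qfactor (N ∸ k))
  first with ℕP.m≤n⇒m<n∨m≡n k≤N
  ... | inj₂ refl = begin
    gauss k (suc k) ⊛ (qPoch (k ∸ k) ⊛ qPoch (suc k))
      ≈⟨ ≈-trans (⊛-congʳ P (gauss-above k (suc k) ℕP.≤-refl)) (⊛-zeroˡ P) ⟩
    zeroS
      ≈⟨ ≈-sym (≈-trans (⊛-congˡ (qPoch k) qfactor-0) (⊛-zeroʳ (qPoch k))) ⟩
    qPoch k ⊛ qfactor (k ∸ k) ∎
    where
    P : Series
    P = qPoch (k ∸ k) ⊛ qPoch (suc k)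
    qfactor-0 : qfactor (k ∸ k) ≈ zeroS
    qfactor-0 j = trans (cong (λ t → qfactor t j) (ℕP.n∸n≡0 k)) (ℤP.+-inverseʳ (oneS j))
  ... | inj₁ k<N = subst (λ t → (gauss N (suc k) ⊛ (qPoch t ⊛ qPoch (suc k))) ≈ (qPoch N ⊛ qfactor t))
                         (sym (ℕP.+-∸-assoc 1 k<N))
    (≈-trans (regroup₁ (gauss N (suc k)) (qPoch (N ∸ suc k)) (qfactor (suc (N ∸ suc k))) (qPoch (suc k)))
             (⊛-congʳ (qfactor (suc (N ∸ suc k))) (gauss-factorial N (suc k) k<N)))

qbinom-above : ∀ N k → N < k → qbinom N k ≡ zeroS
qbinom-above N k N<k = if-false (λ k≤ᵇN → ℕP.<⇒≱ N<k (ℕP.≤ᵇ⇒≤ k N k≤ᵇN))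

qbinom-gauss : ∀ N k → k ≤ N → qbinom N k ≈ gauss N k
qbinom-gauss N k k≤N = begin
  qbinom N k                 ≈⟨ (λ j → cong (λ s → s j) (if-true {b = k ≤ᵇ N} {x = qPoch N ⊛ inv D} {y = zeroS} (ℕP.≤⇒≤ᵇ k≤N))) ⟩
  qPoch N ⊛ inv D            ≈⟨ ⊛-congʳ (inv D) (≈-sym (gauss-factorial N k k≤N)) ⟩
  (gauss N k ⊛ D) ⊛ inv D    ≈⟨ ⊛-assoc (gauss N k) D (inv D) ⟩
  gauss N k ⊛ (D ⊛ inv D)    ≈⟨ ⊛-congˡ (gauss N k) (inv-inverseʳ D D₀≡1) ⟩
  gauss N k ⊛ oneS           ≈⟨ ⊛-identityʳ (gauss N k) ⟩
  gauss N k                  ∎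
  where
  open ≈-Reasoning
  D : Series
  D = qPoch (N ∸ k) ⊛ qPoch k
  D₀≡1 : D 0 ≡ + 1
  D₀≡1 = trans (⊛-at-0 (qPoch (N ∸ k)) (qPoch k)) (cong₂ _*_ (qPoch-at-0 (N ∸ k)) (qPoch-at-0 k))

binomExp : ℕ → ℕ → ℕ
binomExp a zero    = 0
binomExp a (suc k) = binomExp a k ℕ.+ (a ℕ.+ k)

binomExp-pascal : ∀ a N k → k ≤ N → (N ∸ k) ℕ.+ binomExp a (suc k) ≡ binomExp a k ℕ.+ (a ℕ.+ N)
binomExp-pascal a N k k≤N =
  trans (shuffle (N ∸ k) (binomExp a k) a k) (cong (λ t → binomExp a k ℕ.+ (a ℕ.+ t)) (ℕP.m∸n+n≡m k≤N))
  where
  shuffle : ∀ d x a k → d ℕ.+ (x ℕ.+ (a ℕ.+ k)) ≡ x ℕ.+ (a ℕ.+ (d ℕ.+ k))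
  shuffle = ℕSolver.solve-∀

sign : ℕ → Series
sign k = constant ((- + 1) ℤ.^ k)

sign-suc : ∀ k → sign (suc k) ≈ (⊝ sign k)
sign-suc k zero    = ℤP.-1*i≡-i ((- + 1) ℤ.^ k)
sign-suc k (suc j) = refl

binomTerm : ℕ → ℕ → ℕ → Series
binomTerm a N k = sign k ⊛ (gauss N k ⊛ qpow (binomExp a k))

binomTerm-pascal : ∀ a N k → k ≤ N →
  binomTerm a (suc N) (suc k) ≈ (binomTerm a N (suc k) ⊖ (binomTerm a N k ⊛ qpow (a ℕ.+ N)))
binomTerm-pascal a N k k≤N = begin
  s′ ⊛ ((g₁ ⊕ (Q ⊛ g₂)) ⊛ p)                         ≈⟨ expand s′ g₁ Q g₂ p ⟩
  (s′ ⊛ (g₁ ⊛ p)) ⊕ ((s′ ⊛ g₂) ⊛ (Q ⊛ p))            ≈⟨ ⊕-cong {s′ ⊛ (g₁ ⊛ p)} ≈-refl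
                                                         (⊛-cong (⊛-congʳ g₂ (sign-suc k)) exponent) ⟩
  (s′ ⊛ (g₁ ⊛ p)) ⊕ (((⊝ s) ⊛ g₂) ⊛ (r ⊛ Qₙ))        ≈⟨ regroup (s′ ⊛ (g₁ ⊛ p)) s g₂ r Qₙ ⟩
  (s′ ⊛ (g₁ ⊛ p)) ⊖ ((s ⊛ (g₂ ⊛ r)) ⊛ Qₙ)            ∎
  where
  open ≈-Reasoning
  s s′ g₁ g₂ Q p r Qₙ : Series
  s = sign k
  s′ = sign (suc k)
  g₁ = gauss N (suc k)
  g₂ = gauss N k
  Q = qpow (N ∸ k)
  p = qpow (binomExp a (suc k))
  r = qpow (binomExp a k)
  Qₙ = qpow (a ℕ.+ N)
  exponent : (Q ⊛ p) ≈ (r ⊛ Qₙ)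
  exponent = ≈-trans (qpow-+ (N ∸ k) _)
                     (≈-trans (qpow-cong (binomExp-pascal a N k k≤N)) (≈-sym (qpow-+ (binomExp a k) _)))
  expand : ∀ s g₁ Q g₂ p → (s ⊛ ((g₁ ⊕ (Q ⊛ g₂)) ⊛ p)) ≈ ((s ⊛ (g₁ ⊛ p)) ⊕ ((s ⊛ g₂) ⊛ (Q ⊛ p)))
  expand = solve 5 (λ s g₁ Q g₂ p → s :* ((g₁ :+ (Q :* g₂)) :* p) := (s :* (g₁ :* p)) :+ ((s :* g₂) :* (Q :* p))) ≈-refl
  regroup : ∀ x s g r Q → (x ⊕ (((⊝ s) ⊛ g) ⊛ (r ⊛ Q))) ≈ (x ⊖ ((s ⊛ (g ⊛ r)) ⊛ Q))
  regroup = solve 5 (λ x s g r Q → x :+ (((:- s) :* g) :* (r :* Q)) := x :- ((s :* (g :* r)) :* Q)) ≈-refl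

q-binomial : ∀ a N → poch a N ≈ ΣS (suc N) (binomTerm a N)
q-binomial a zero    j = sym (trans (ℤP.+-identityˡ _) (trans (⊛-identityˡ (oneS ⊛ oneS) j) (⊛-identityˡ oneS j)))
q-binomial a (suc N) = begin
  poch a N ⊛ qfactor (a ℕ.+ N)          ≈⟨ ⊛-congʳ (qfactor (a ℕ.+ N)) (q-binomial a N) ⟩
  S ⊛ qfactor (a ℕ.+ N)                 ≈⟨ ⊛-qfactor S Qₙ ⟩
  S ⊖ (S ⊛ Qₙ)                          ≈⟨ ⊖-cong (ΣS-head N t) (ΣS-⊛ʳ (suc N) t Qₙ) ⟩
  (t 0 ⊕ ΣS N (λ k → t (suc k))) ⊖ ΣS (suc N) (λ k → t k ⊛ Qₙ)
    ≈⟨ ⊖-cong (⊕-cong t′₀≈t₀ (≈-sym (ΣS-dropLast N (λ k → t (suc k)) tₙ₊₁≈0))) ≈-refl ⟩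
  (t′ 0 ⊕ ΣS (suc N) (λ k → t (suc k))) ⊖ ΣS (suc N) (λ k → t k ⊛ Qₙ)
    ≈⟨ ⊕-assoc-⊖ (t′ 0) _ _ ⟩
  t′ 0 ⊕ (ΣS (suc N) (λ k → t (suc k)) ⊖ ΣS (suc N) (λ k → t k ⊛ Qₙ))
    ≈⟨ ⊕-cong {t′ 0} ≈-refl (≈-sym (ΣS-⊖ (suc N) (λ k → t (suc k)) (λ k → t k ⊛ Qₙ))) ⟩
  t′ 0 ⊕ ΣS (suc N) (λ k → t (suc k) ⊖ (t k ⊛ Qₙ))
    ≈⟨ ⊕-cong {t′ 0} ≈-refl (ΣS-cong (suc N) (λ k k≤N → ≈-sym (binomTerm-pascal a N k (ℕP.≤-pred k≤N)))) ⟩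
  t′ 0 ⊕ ΣS (suc N) (λ k → t′ (suc k))  ≈⟨ ≈-sym (ΣS-head (suc N) t′) ⟩
  ΣS (suc (suc N)) t′                   ∎
  where
  open ≈-Reasoning
  t t′ : ℕ → Series
  t = binomTerm a N
  t′ = binomTerm a (suc N)
  S Qₙ : Series
  S = ΣS (suc N) t
  Qₙ = qpow (a ℕ.+ N)
  t′₀≈t₀ : t 0 ≈ t′ 0
  t′₀≈t₀ = ⊛-congˡ (sign 0) (⊛-congʳ (qpow 0) (≈-trans (gauss-0 N) (≈-sym (gauss-0 (suc N)))))
  tₙ₊₁≈0 : t (suc N) ≈ zeroS
  tₙ₊₁≈0 = ≈-trans (⊛-congˡ (sign (suc N)) (≈-trans (⊛-congʳ (qpow (binomExp a (suc N))) (gauss-above N (suc N) ℕP.≤-refl))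
                                                      (⊛-zeroˡ (qpow (binomExp a (suc N))))))
                   (⊛-zeroʳ (sign (suc N)))
  ⊕-assoc-⊖ : ∀ x y z → ((x ⊕ y) ⊖ z) ≈ (x ⊕ (y ⊖ z))
  ⊕-assoc-⊖ x y z k = ℤP.+-assoc (x k) (y k) (- z k)

triangle : ℕ → ℕ
triangle zero    = 0
triangle (suc k) = triangle k ℕ.+ suc k

triangle-double : ∀ k → k ℕ.* suc k ≡ triangle k ℕ.* 2
triangle-double zero    = refl
triangle-double (suc k) = begin
  suc k ℕ.* suc (suc k)              ≡⟨ expand k ⟩
  k ℕ.* suc k ℕ.+ suc k ℕ.* 2        ≡⟨ cong (ℕ._+ suc k ℕ.* 2) (triangle-double k) ⟩
  triangle k ℕ.* 2 ℕ.+ suc k ℕ.* 2   ≡⟨ ℕP.*-distribʳ-+ 2 (triangle k) (suc k) ⟨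
  triangle (suc k) ℕ.* 2             ∎
  where
  open ≡-Reasoning
  expand : ∀ k → suc k ℕ.* suc (suc k) ≡ k ℕ.* suc k ℕ.+ suc k ℕ.* 2
  expand = ℕSolver.solve-∀

triangle-formula : ∀ k → (k ℕ.* suc k) / 2 ≡ triangle k
triangle-formula k = trans (cong (_/ 2) (triangle-double k)) (m*n/n≡m (triangle k) 2)

binomExp-triangle : ∀ n k → binomExp (suc n) k ≡ triangle k ℕ.+ n ℕ.* k
binomExp-triangle n zero    = sym (ℕP.*-zeroʳ n)
binomExp-triangle n (suc k) = begin
  binomExp (suc n) k ℕ.+ (suc n ℕ.+ k)           ≡⟨ cong (ℕ._+ (suc n ℕ.+ k)) (binomExp-triangle n k) ⟩
  triangle k ℕ.+ n ℕ.* k ℕ.+ (suc n ℕ.+ k)       ≡⟨ shuffle (triangle k) n k ⟩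
  triangle k ℕ.+ suc k ℕ.+ (n ℕ.+ n ℕ.* k)       ≡⟨ cong (triangle (suc k) ℕ.+_) (ℕP.*-suc n k) ⟨
  triangle (suc k) ℕ.+ n ℕ.* suc k               ∎
  where
  open ≡-Reasoning
  shuffle : ∀ t n k → t ℕ.+ n ℕ.* k ℕ.+ (suc n ℕ.+ k) ≡ t ℕ.+ suc k ℕ.+ (n ℕ.+ n ℕ.* k)
  shuffle = ℕSolver.solve-∀

finite-hasSum : ∀ F M {S} → (∀ n → M ≤ n → F n ≈ zeroS) → S ≈ ΣS M F → HasSum F S
finite-hasSum F M F≈0 S≈ΣF j = M , λ m M≤m →
  trans (Σ-extend M m M≤m (λ n M≤n _ → F≈0 n M≤n j)) (sym (S≈ΣF j))

reassoc : ∀ s g a b → (s ⊛ (g ⊛ (a ⊛ b))) ≈ ((s ⊛ (g ⊛ a)) ⊛ b)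
reassoc = solve 4 (λ s g a b → s :* (g :* (a :* b)) := (s :* (g :* a)) :* b) ≈-refl

-- The identity itself, for fixed N.  coeff k is the factor
-- (-1)^{k+1} [N, k+1] q^{(k+1)(k+2)/2} shared by both sides.

module _ (N : ℕ) where

  coeff : ℕ → Series
  coeff k = sign (suc k) ⊛ (gauss N (suc k) ⊛ qpow (triangle (suc k)))

  poch-1-expansion : ∀ n → (poch (suc n) N ⊖ oneS) ≈ ΣS N (λ k → coeff k ⊛ qpow (n ℕ.* suc k))
  poch-1-expansion n = begin
    poch (suc n) N ⊖ oneS                         ≈⟨ ⊖-cong {c = oneS} (≈-trans (q-binomial (suc n) N) (ΣS-head N t)) ≈-refl ⟩
    (t 0 ⊕ ΣS N (λ k → t (suc k))) ⊖ oneS         ≈⟨ ⊖-cong {c = oneS} (⊕-cong t₀≈1 (ΣS-cong N (λ k _ → tₖ₊₁ k))) ≈-refl ⟩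
    (oneS ⊕ ΣS N (λ k → coeff k ⊛ qpow (n ℕ.* suc k))) ⊖ oneS
                                                   ≈⟨ cancel oneS _ ⟩
    ΣS N (λ k → coeff k ⊛ qpow (n ℕ.* suc k))     ∎
    where
    open ≈-Reasoning
    t : ℕ → Series
    t = binomTerm (suc n) N
    cancel : ∀ o x → ((o ⊕ x) ⊖ o) ≈ x
    cancel = solve 2 (λ o x → (o :+ x) :- o := x) ≈-refl
    t₀≈1 : t 0 ≈ oneS
    t₀≈1 = ≈-trans (⊛-identityˡ (gauss N 0 ⊛ qpow 0))
                   (≈-trans (⊛-congʳ (qpow 0) (gauss-0 N)) (⊛-identityˡ (qpow 0)))
    tₖ₊₁ : ∀ k → t (suc k) ≈ (coeff k ⊛ qpow (n ℕ.* suc k))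
    tₖ₊₁ k = ≈-trans (⊛-congˡ (sign (suc k)) (⊛-congˡ (gauss N (suc k))
                        (≈-trans (qpow-cong (binomExp-triangle n (suc k))) (≈-sym (qpow-+ (triangle (suc k)) (n ℕ.* suc k))))))
                     (reassoc (sign (suc k)) (gauss N (suc k)) (qpow (triangle (suc k))) (qpow (n ℕ.* suc k)))

  lhsTerm-expansion : ∀ n → lhsTerm N n ≈ ΣS N (λ k → coeff k ⊛ eulerTerm (suc k) n)
  lhsTerm-expansion n = begin
    Tail n ⊛ (poch (suc n) N ⊖ oneS)                     ≈⟨ ⊛-congˡ (Tail n) (poch-1-expansion n) ⟩
    Tail n ⊛ ΣS N (λ k → coeff k ⊛ qpow (n ℕ.* suc k))   ≈⟨ ΣS-⊛ˡ N (λ k → coeff k ⊛ qpow (n ℕ.* suc k)) (Tail n) ⟩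
    ΣS N (λ k → Tail n ⊛ (coeff k ⊛ qpow (n ℕ.* suc k))) ≈⟨ ΣS-cong N (λ k _ → rotate (Tail n) (coeff k) (qpow (n ℕ.* suc k))) ⟩
    ΣS N (λ k → coeff k ⊛ eulerTerm (suc k) n)           ∎
    where
    open ≈-Reasoning
    rotate : ∀ x c q → (x ⊛ (c ⊛ q)) ≈ (c ⊛ (q ⊛ x))
    rotate = solve 3 (λ x c q → x :* (c :* q) := c :* (q :* x)) ≈-refl

  lhsTerm-summable : Summable (lhsTerm N)
  lhsTerm-summable n = Ord≥-mono (ℕP.n≤1+n n) (Ord≥-⊛ʳ (Tail n) (poch-Ord≥ n N))

  lhs-sum : Σ∞ (lhsTerm N) ≈ ΣS N (λ k → coeff k ⊛ qPoch k)
  lhs-sum = begin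
    Σ∞ (lhsTerm N)                                       ≈⟨ Σ∞-cong lhsTerm-expansion ⟩
    Σ∞ (λ n → ΣS N (λ k → coeff k ⊛ eulerTerm (suc k) n)) ≈⟨ Σ∞-ΣS N (λ k n → coeff k ⊛ eulerTerm (suc k) n) ⟩
    ΣS N (λ k → Σ∞ (λ n → coeff k ⊛ eulerTerm (suc k) n)) ≈⟨ ΣS-cong N (λ k _ → sum-k k) ⟩
    ΣS N (λ k → coeff k ⊛ qPoch k)                       ∎
    where
    open ≈-Reasoning
    sum-k : ∀ k → Σ∞ (λ n → coeff k ⊛ eulerTerm (suc k) n) ≈ (coeff k ⊛ qPoch k)
    sum-k k = ≈-trans (Σ∞-⊛ (coeff k) (eulerTerm (suc k)) (eulerTerm-summable k))
                      (⊛-congˡ (coeff k) (euler-qPoch k))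

  qPoch-quotient : ∀ k → (qPoch (suc k) ⊛ inv (qfactor (suc k))) ≈ qPoch k
  qPoch-quotient k = begin
    (qPoch k ⊛ qfactor (suc k)) ⊛ inv (qfactor (suc k)) ≈⟨ ⊛-assoc (qPoch k) (qfactor (suc k)) (inv (qfactor (suc k))) ⟩
    qPoch k ⊛ (qfactor (suc k) ⊛ inv (qfactor (suc k))) ≈⟨ ⊛-congˡ (qPoch k) (inv-inverseʳ (qfactor (suc k)) refl) ⟩
    qPoch k ⊛ oneS                                      ≈⟨ ⊛-identityʳ (qPoch k) ⟩
    qPoch k                                             ∎
    where open ≈-Reasoning

  rhsTerm-coeff : ∀ k → k < N → rhsTerm N (suc k) ≈ (coeff k ⊛ qPoch k)
  rhsTerm-coeff k k<N = begin
    rhsTerm N (suc k)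
      ≈⟨ ·≈constant⊛ _ _ ⟩
    sign (suc k) ⊛ (qbinom N (suc k) ⊛ (qpow ((suc k ℕ.* suc (suc k)) / 2) ⊛ (qPoch (suc k) ⊛ inv (qfactor (suc k)))))
      ≈⟨ ⊛-congˡ (sign (suc k)) (⊛-cong (qbinom-gauss N (suc k) k<N)
                                        (⊛-cong (qpow-cong (triangle-formula (suc k))) (qPoch-quotient k))) ⟩
    sign (suc k) ⊛ (gauss N (suc k) ⊛ (qpow (triangle (suc k)) ⊛ qPoch k))
      ≈⟨ reassoc (sign (suc k)) (gauss N (suc k)) (qpow (triangle (suc k))) (qPoch k) ⟩
    coeff k ⊛ qPoch k ∎
    where
    open ≈-Reasoning

  rhsTerm-above : ∀ n → N < n → rhsTerm N n ≈ zeroS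
  rhsTerm-above (suc n) N<n j rewrite qbinom-above N (suc n) N<n =
    trans (cong ((- + 1) ℤ.^ suc n *_) (⊛-zeroˡ (qpow ((suc n ℕ.* suc (suc n)) / 2) ⊛ (qPoch (suc n) ⊛ inv (qfactor (suc n)))) j)) (ℤP.*-zeroʳ ((- + 1) ℤ.^ suc n))

  lhs≈rhs : Σ∞ (lhsTerm N) ≈ ΣS (suc N) (rhsTerm N)
  lhs≈rhs = begin
    Σ∞ (lhsTerm N)                     ≈⟨ lhs-sum ⟩
    ΣS N (λ k → coeff k ⊛ qPoch k)     ≈⟨ ≈-sym (ΣS-cong N rhsTerm-coeff) ⟩
    ΣS N (λ k → rhsTerm N (suc k))     ≈⟨ (λ j → sym (ℤP.+-identityˡ _)) ⟩
    zeroS ⊕ ΣS N (λ k → rhsTerm N (suc k)) ≈⟨ ≈-sym (ΣS-head N (rhsTerm N)) ⟩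
    ΣS (suc N) (rhsTerm N)             ∎
    where open ≈-Reasoning

corollary3p6 : (N : ℕ) → 1 ≤ N →
    ∃[ S ] (HasSum (lhsTerm N) S × HasSum (rhsTerm N) S)
corollary3p6 N _ =
  Σ∞ (lhsTerm N) ,
  Σ∞-hasSum (lhsTerm N) (lhsTerm-summable N) ,
  finite-hasSum (rhsTerm N) (suc N) (rhsTerm-above N) (lhs≈rhs N)
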